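{- Let $p,q$ be nonnegative integers. If $p\ge 1$ and $q\ge 1$, then $|E(A_{p,q})|=q\binom{p+q-1}{p-1}$; and if $pq=0$, then $|E(A_{p,q})|=0$.
   Context: For nonnegative integers $p,q$, the graph $A_{p,q}$ is the simple graph whose vertices are all words of length $p+q$ over $\{a,b\}$ with exactly $p$ letters $a$ and $q$ letters $b$; two words are adjacent if one can be obtained from the other by changing one subword (block of two consecutive letters) $ab$ to $ba$. -}

module Defs where

open import Data.Fin.Properties using () renaming (≡-setoid to Fin-setoid)
open import Data.List.Base using (List; []; _∷_; _++_; length; filter)
open import Data.List.Properties using (++-cancelˡ)
open import Data.Nat.Base using (ℕ; _+_)
open import Data.Product.Base using (_×_; _,_; ∃₂)
open import Data.Refinement.Base using (Refinement; Refinement-syntax; value)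
open import Data.Sum.Base using (_⊎_; inj₁; inj₂; swap; [_,_]′)
open import Function.Bundles using (Inverse)
open import Level using (0ℓ)
open import Relation.Binary.Bundles using (Setoid)
open import Relation.Binary.Core using (Rel)
open import Relation.Binary.Definitions using (DecidableEquality; Symmetric; Irreflexive)
open import Relation.Binary.PropositionalEquality using (_≡_; refl; sym; trans)
open import Relation.Nullary.Decidable.Core using (yes; no)
open import Relation.Nullary.Negation.Core using (¬_)

record SimpleGraph : Set₁ where
  field
    Vertex : Set
    Adj    : Rel Vertex 0ℓ
    symm   : Symmetric Adj
    irrefl : Irreflexive _≡_ Adj

module _ (G : SimpleGraph) where
  open SimpleGraph G

  record Edge : Set where
    constructor edge
    field
      {end₁ end₂} : Vertex
      adjacent    : Adj end₁ end₂

  open Edge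

  -- Edges are unordered pairs of vertices: orientation is forgotten, and so is
  -- the choice of adjacency proof.
  _≈ᴱ_ : Rel Edge 0ℓ
  e ≈ᴱ f = (end₁ e ≡ end₁ f × end₂ e ≡ end₂ f)
         ⊎ (end₁ e ≡ end₂ f × end₂ e ≡ end₁ f)

  edgeSetoid : Setoid 0ℓ 0ℓ
  edgeSetoid = record
    { Carrier       = Edge
    ; _≈_           = _≈ᴱ_
    ; isEquivalence = record
      { refl  = inj₁ (refl , refl)
      ; sym   = λ { (inj₁ (p , q)) → inj₁ (sym p , sym q)
                  ; (inj₂ (p , q)) → inj₂ (sym q , sym p) }
      ; trans = λ { (inj₁ (p , q)) (inj₁ (r , s)) → inj₁ (trans p r , trans q s)
                  ; (inj₁ (p , q)) (inj₂ (r , s)) → inj₂ (trans p r , trans q s)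
                  ; (inj₂ (p , q)) (inj₁ (r , s)) → inj₂ (trans p s , trans q r)
                  ; (inj₂ (p , q)) (inj₂ (r , s)) → inj₁ (trans p s , trans q r) }
      }
    }

-- |E(G)| = n, as a bijection between the set of edges and Fin n.
∣E_∣≡_ : SimpleGraph → ℕ → Set
∣E G ∣≡ n = Inverse (edgeSetoid G) (Fin-setoid n)

infix 4 ∣E_∣≡_

data Letter : Set where
  a b : Letter

_≟_ : DecidableEquality Letter
a ≟ a = yes refl
a ≟ b = no λ ()
b ≟ a = no λ ()
b ≟ b = yes refl

Word : Set
Word = List Letter

occurrences : Letter → Word → ℕ
occurrences x w = length (filter (x ≟_) w)

_⟶_ : Rel Word 0ℓ
u ⟶ v = ∃₂ λ xs ys → u ≡ xs ++ a ∷ b ∷ ys × v ≡ xs ++ b ∷ a ∷ ys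

⟶-irrefl : ∀ w → ¬ (w ⟶ w)
⟶-irrefl _ (xs , _ , p , q) with () ← ++-cancelˡ xs _ _ (trans (sym p) q)

-- The counting conditions are irrelevant in a refinement type, so two vertices
-- are propositionally equal exactly when their words are.
A : ℕ → ℕ → SimpleGraph
A p q = record
  { Vertex = [ w ∈ Word ∣ length w ≡ p + q × occurrences a w ≡ p × occurrences b w ≡ q ]
  ; Adj    = λ u v → (value u ⟶ value v) ⊎ (value v ⟶ value u)
  ; symm   = swap
  ; irrefl = λ { {u} refl → [ ⟶-irrefl (value u) , ⟶-irrefl (value u) ]′ }
  }

{-# OPTIONS --safe #-}
-- An edge of A p q amounts to a word with one marked factor ab, namely the
-- factor that the edge turns into ba. Splitting off the first letter of such a
-- word, or the marked factor when it comes first, gives the recurrence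
--   e (1 + p) (1 + q) = C (p + q, p) + e p (1 + q) + e (1 + p) q
-- for the number e p q of edges, and Pascal's rule shows that the closed formula
-- satisfies it.
module Submission where

open import Defs
open import Data.Empty using (⊥-elim)
open import Data.Fin.Base using (Fin)
open import Data.Fin.Properties using (+↔⊎; 0↔⊥; 1↔⊤)
open import Data.List.Base using ([]; _∷_; _++_; length)
open import Data.List.Properties using (∷-injectiveʳ)
open import Data.Nat.Base using (ℕ; zero; suc; _+_; _*_; _∸_; _≤_)
open import Data.Nat.Combinatorics using (_C_; nCn≡1; nCk+nC[k+1]≡[n+1]C[k+1])
import Data.Nat.Properties as ℕ
open import Data.Nat.Solver using (module +-*-Solver)
open import Data.Product.Base using (_×_; _,_; proj₁; proj₂; ∃)
open import Data.Refinement.Base using (_,_; value)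
open import Data.Refinement.Properties using (value-injective)
open import Data.Irrelevant using ([_])
open import Data.Sum.Base using (_⊎_; inj₁; inj₂)
open import Data.Sum.Function.Propositional using (_⊎-↔_)
open import Data.Unit.Base using (⊤; tt)
open import Function.Base using (_∘_)
open import Function.Bundles using (Bijection; _↔_; mk↔ₛ′)
import Function.Construct.Composition as Composition
import Function.Construct.Symmetry as Symmetry
open import Function.Properties.Bijection using (Bijection⇒Inverse)
open import Function.Properties.Inverse using (↔-sym; ↔-trans)
open import Relation.Binary.Bundles using (Setoid)
open import Relation.Binary.PropositionalEquality
  using (_≡_; refl; sym; trans; cong; cong₂; subst; setoid; module ≡-Reasoning)
open import Relation.Nullary.Decidable.Core using (recompute)
open import Relation.Nullary.Negation.Core using (¬_)

open SimpleGraph using (Vertex)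

-- Words and words with a marked factor, indexed by their letter counts

data Shuffle : ℕ → ℕ → Set where
  []  : Shuffle 0 0
  a∷_ : ∀ {p q} → Shuffle p q → Shuffle (suc p) q
  b∷_ : ∀ {p q} → Shuffle p q → Shuffle p (suc q)

-- The only base constructor is `ab∷_`, which continues with an unmarked word, so exactly one factor
-- carries the mark.
data MarkedShuffle : ℕ → ℕ → Set where
  ab∷_ : ∀ {p q} → Shuffle p q → MarkedShuffle (suc p) (suc q)
  a∷_  : ∀ {p q} → MarkedShuffle p q → MarkedShuffle (suc p) q
  b∷_  : ∀ {p q} → MarkedShuffle p q → MarkedShuffle p (suc q)

private
  variable
    p q : ℕ

word : Shuffle p q → Word
word []     = []
word (a∷ s) = a ∷ word s
word (b∷ s) = b ∷ word s

source target : MarkedShuffle p q → Word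
source (ab∷ s) = a ∷ b ∷ word s
source (a∷ m)  = a ∷ source m
source (b∷ m)  = b ∷ source m
target (ab∷ s) = b ∷ a ∷ word s
target (a∷ m)  = a ∷ target m
target (b∷ m)  = b ∷ target m

word-injective : (s t : Shuffle p q) → word s ≡ word t → s ≡ t
word-injective []     []     _  = refl
word-injective (a∷ s) (a∷ t) eq = cong a∷_ (word-injective s t (∷-injectiveʳ eq))
word-injective (b∷ s) (b∷ t) eq = cong b∷_ (word-injective s t (∷-injectiveʳ eq))

-- The source alone may contain several factors ab. The first place where source and target differ
-- locates the mark, so a mark at the front of only one of `m`, `n` contradicts one of the
-- equations.
source-target-injective : (m n : MarkedShuffle p q) →
  source m ≡ source n → target m ≡ target n → m ≡ n
source-target-injective (ab∷ s) (ab∷ t) eq _ =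
  cong ab∷_ (word-injective s t (∷-injectiveʳ (∷-injectiveʳ eq)))
source-target-injective (a∷ m) (a∷ n) eq eq′ =
  cong a∷_ (source-target-injective m n (∷-injectiveʳ eq) (∷-injectiveʳ eq′))
source-target-injective (b∷ m) (b∷ n) eq eq′ =
  cong b∷_ (source-target-injective m n (∷-injectiveʳ eq) (∷-injectiveʳ eq′))

-- Where source and target first differ, the source has `a` and the target has `b`; exchanging the
-- roles would require the opposite.
source-target-asymmetric : (m n : MarkedShuffle p q) →
  source m ≡ target n → ¬ target m ≡ source n
source-target-asymmetric (ab∷ s) (ab∷ t) ()
source-target-asymmetric (a∷ m)  (ab∷ t) ()
source-target-asymmetric (b∷ m)  (ab∷ t) eq ()
source-target-asymmetric (a∷ m) (a∷ n) eq eq′ =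
  source-target-asymmetric m n (∷-injectiveʳ eq) (∷-injectiveʳ eq′)
source-target-asymmetric (b∷ m) (b∷ n) eq eq′ =
  source-target-asymmetric m n (∷-injectiveʳ eq) (∷-injectiveʳ eq′)

∷-⟶ : ∀ x {u v} → u ⟶ v → (x ∷ u) ⟶ (x ∷ v)
∷-⟶ x (xs , ys , refl , refl) = x ∷ xs , ys , refl , refl

source⟶target : (m : MarkedShuffle p q) → source m ⟶ target m
source⟶target (ab∷ s) = [] , word s , refl , refl
source⟶target (a∷ m)  = ∷-⟶ a (source⟶target m)
source⟶target (b∷ m)  = ∷-⟶ b (source⟶target m)

-- Letter counts, and every word as a shuffle

record Balanced (p q : ℕ) (w : Word) : Set where
  constructor balanced
  field
    #a : occurrences a w ≡ p
    #b : occurrences b w ≡ q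

a∷-balanced : ∀ {w} → Balanced p q w → Balanced (suc p) q (a ∷ w)
a∷-balanced (balanced refl refl) = balanced refl refl

b∷-balanced : ∀ {w} → Balanced p q w → Balanced p (suc q) (b ∷ w)
b∷-balanced (balanced refl refl) = balanced refl refl

word-balanced : (s : Shuffle p q) → Balanced p q (word s)
word-balanced []     = balanced refl refl
word-balanced (a∷ s) = a∷-balanced (word-balanced s)
word-balanced (b∷ s) = b∷-balanced (word-balanced s)

source-balanced : (m : MarkedShuffle p q) → Balanced p q (source m)
source-balanced (ab∷ s) = a∷-balanced (b∷-balanced (word-balanced s))
source-balanced (a∷ m)  = a∷-balanced (source-balanced m)
source-balanced (b∷ m)  = b∷-balanced (source-balanced m)

target-balanced : (m : MarkedShuffle p q) → Balanced p q (target m)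
target-balanced (ab∷ s) = b∷-balanced (a∷-balanced (word-balanced s))
target-balanced (a∷ m)  = a∷-balanced (target-balanced m)
target-balanced (b∷ m)  = b∷-balanced (target-balanced m)

-- Matching the counts with `refl` replaces `p` and `q` by the letter counts of the word, which
-- compute letter by letter and so give each constructor its indices.
word-surjective : ∀ w → Balanced p q w → ∃ λ (s : Shuffle p q) → word s ≡ w
word-surjective []      (balanced refl refl) = [] , refl
word-surjective (a ∷ w) (balanced refl refl) with s , eq ← word-surjective w (balanced refl refl) =
  a∷ s , cong (a ∷_) eq
word-surjective (b ∷ w) (balanced refl refl) with s , eq ← word-surjective w (balanced refl refl) =
  b∷ s , cong (b ∷_) eq

-- Each letter of `xs` becomes a constructor, the displayed factor becomes the mark, and `ys` is
-- encoded by `word-surjective`.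
source-target-surjective : ∀ xs ys → Balanced p q (xs ++ a ∷ b ∷ ys) →
  ∃ λ (m : MarkedShuffle p q) →
    source m ≡ xs ++ a ∷ b ∷ ys × target m ≡ xs ++ b ∷ a ∷ ys
source-target-surjective [] ys (balanced refl refl)
  with s , eq ← word-surjective ys (balanced refl refl) =
  ab∷ s , cong (λ w → a ∷ b ∷ w) eq , cong (λ w → b ∷ a ∷ w) eq
source-target-surjective (a ∷ xs) ys (balanced refl refl)
  with m , eq , eq′ ← source-target-surjective xs ys (balanced refl refl) =
  a∷ m , cong (a ∷_) eq , cong (a ∷_) eq′
source-target-surjective (b ∷ xs) ys (balanced refl refl)
  with m , eq , eq′ ← source-target-surjective xs ys (balanced refl refl) =
  b∷ m , cong (b ∷_) eq , cong (b ∷_) eq′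

length≡occurrences : ∀ w → length w ≡ occurrences a w + occurrences b w
length≡occurrences []      = refl
length≡occurrences (a ∷ w) = cong suc (length≡occurrences w)
length≡occurrences (b ∷ w) = trans (cong suc (length≡occurrences w)) (sym (ℕ.+-suc _ _))

vertex : ∀ w → Balanced p q w → Vertex (A p q)
vertex w (balanced #a #b) = w , [ (trans (length≡occurrences w) (cong₂ _+_ #a #b) , #a , #b) ]

vertex-balanced : (v : Vertex (A p q)) → Balanced p q (value v)
vertex-balanced (w , [ c ]) =
  -- The counts stored in a vertex are irrelevant; decidability of equality on `ℕ` recovers usable
  -- proofs of them.
  balanced (recompute (_ ℕ.≟ _) (proj₁ (proj₂ c))) (recompute (_ ℕ.≟ _) (proj₂ (proj₂ c)))

-- Edges as marked shuffles

module _ {p q : ℕ} where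
  open Setoid (edgeSetoid (A p q)) using (_≈_)

  markedEdge : MarkedShuffle p q → Edge (A p q)
  markedEdge m = edge {end₁ = vertex (source m) (source-balanced m)}
                      {end₂ = vertex (target m) (target-balanced m)}
                      (inj₁ (source⟶target m))

  markedEdge-injective : ∀ {m n} → markedEdge m ≈ markedEdge n → m ≡ n
  markedEdge-injective {m} {n} (inj₁ (eq , eq′)) =
    source-target-injective m n (cong value eq) (cong value eq′)
  markedEdge-injective {m} {n} (inj₂ (eq , eq′)) =
    ⊥-elim (source-target-asymmetric m n (cong value eq) (cong value eq′))

  -- The mark is read off at the endpoint containing ab; if that is the second endpoint, the edges
  -- agree with reversed orientation.
  markedEdge-surjective : ∀ e → ∃ λ m → markedEdge m ≈ e
  markedEdge-surjective (edge {u} {v} (inj₁ (xs , ys , refl , refl)))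
    with m , eq , eq′ ← source-target-surjective xs ys (vertex-balanced u) =
    m , inj₁ (value-injective eq , value-injective eq′)
  markedEdge-surjective (edge {u} {v} (inj₂ (xs , ys , refl , refl)))
    with m , eq , eq′ ← source-target-surjective xs ys (vertex-balanced v) =
    m , inj₂ (value-injective eq , value-injective eq′)

  markedShuffle⤖edge : Bijection (setoid (MarkedShuffle p q)) (edgeSetoid (A p q))
  markedShuffle⤖edge = record
    { to        = markedEdge
    ; cong      = λ { refl → inj₁ (refl , refl) }
    ; bijective = markedEdge-injective
                , λ e → let m , m≈e = markedEdge-surjective e in
                        m , λ { refl → m≈e }
    }

-- Recurrences and the closed formula

Shuffle₀₀↔⊤ : Shuffle 0 0 ↔ ⊤
Shuffle₀₀↔⊤ = mk↔ₛ′ (λ _ → tt) (λ _ → []) (λ _ → refl) (λ { [] → refl })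

Shuffle-zeroˡ : ∀ q → Shuffle 0 (suc q) ↔ Shuffle 0 q
Shuffle-zeroˡ q = mk↔ₛ′ (λ { (b∷ s) → s }) b∷_ (λ _ → refl) (λ { (b∷ s) → refl })

Shuffle-zeroʳ : ∀ p → Shuffle (suc p) 0 ↔ Shuffle p 0
Shuffle-zeroʳ p = mk↔ₛ′ (λ { (a∷ s) → s }) a∷_ (λ _ → refl) (λ { (a∷ s) → refl })

Shuffle-suc : ∀ p q → Shuffle (suc p) (suc q) ↔ (Shuffle p (suc q) ⊎ Shuffle (suc p) q)
Shuffle-suc p q = mk↔ₛ′
  (λ { (a∷ s) → inj₁ s ; (b∷ s) → inj₂ s })
  (λ { (inj₁ s) → a∷ s ; (inj₂ s) → b∷ s })
  (λ { (inj₁ s) → refl ; (inj₂ s) → refl })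
  (λ { (a∷ s) → refl ; (b∷ s) → refl })

MarkedShuffle-suc : ∀ p q → MarkedShuffle (suc p) (suc q) ↔
  (Shuffle p q ⊎ (MarkedShuffle p (suc q) ⊎ MarkedShuffle (suc p) q))
MarkedShuffle-suc p q = mk↔ₛ′
  (λ { (ab∷ s) → inj₁ s ; (a∷ m) → inj₂ (inj₁ m) ; (b∷ m) → inj₂ (inj₂ m) })
  (λ { (inj₁ s) → ab∷ s ; (inj₂ (inj₁ m)) → a∷ m ; (inj₂ (inj₂ m)) → b∷ m })
  (λ { (inj₁ s) → refl ; (inj₂ (inj₁ m)) → refl ; (inj₂ (inj₂ m)) → refl })
  (λ { (ab∷ s) → refl ; (a∷ m) → refl ; (b∷ m) → refl })

-- The mark uses one letter of each kind, so only `b∷_` fits these indices, and stripping it never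
-- reaches a mark.
¬MarkedShuffle-zeroˡ : ¬ MarkedShuffle 0 q
¬MarkedShuffle-zeroˡ (b∷ m) = ¬MarkedShuffle-zeroˡ m

¬MarkedShuffle-zeroʳ : ¬ MarkedShuffle p 0
¬MarkedShuffle-zeroʳ (a∷ m) = ¬MarkedShuffle-zeroʳ m

¬⇒↔Fin0 : {X : Set} → ¬ X → X ↔ Fin 0
¬⇒↔Fin0 ¬x = ↔-trans (mk↔ₛ′ ¬x (λ ()) (λ ()) (⊥-elim ∘ ¬x)) (↔-sym 0↔⊥)

⊎-↔Fin : ∀ {X Y : Set} {m n} → X ↔ Fin m → Y ↔ Fin n → (X ⊎ Y) ↔ Fin (m + n)
⊎-↔Fin f g = ↔-trans (f ⊎-↔ g) (↔-sym +↔⊎)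

shuffle-count : ∀ p q → Shuffle p q ↔ Fin ((p + q) C p)
shuffle-count zero    zero    = ↔-trans Shuffle₀₀↔⊤ (↔-sym 1↔⊤)
shuffle-count zero    (suc q) = ↔-trans (Shuffle-zeroˡ q) (shuffle-count zero q)
shuffle-count (suc p) zero    = subst (λ n → Shuffle (suc p) 0 ↔ Fin n) eq
  (↔-trans (Shuffle-zeroʳ p) (shuffle-count p zero))
  where
  eq : (p + 0) C p ≡ suc (p + 0) C suc p
  -- Both coefficients now have the form `n C n`, which is 1.
  eq rewrite ℕ.+-identityʳ p = trans (nCn≡1 p) (sym (nCn≡1 (suc p)))
shuffle-count (suc p) (suc q) = subst (λ n → Shuffle (suc p) (suc q) ↔ Fin n) eq
  (↔-trans (Shuffle-suc p q) (⊎-↔Fin (shuffle-count p (suc q)) (shuffle-count (suc p) q)))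
  where
  eq : (p + suc q) C p + (suc p + q) C suc p ≡ (suc p + suc q) C suc p
  eq rewrite ℕ.+-suc p q = nCk+nC[k+1]≡[n+1]C[k+1] (suc (p + q)) p

-- Splitting on the first argument avoids truncated subtraction; for `q` equal to 0 the factor `q`
-- gives 0.
edgeCount : ℕ → ℕ → ℕ
edgeCount zero    q = 0
edgeCount (suc p) q = q * ((p + q) C p)

edgeCount-suc : ∀ p q →
  (p + q) C p + (edgeCount p (suc q) + edgeCount (suc p) q) ≡ edgeCount (suc p) (suc q)
edgeCount-suc zero    q = refl
-- The word with the mark in front contributes the one `y` that completes `q * y` to `suc q * y`;
-- Pascal's rule then adds `x` and `y`.
edgeCount-suc (suc p) q rewrite ℕ.+-suc p q = begin
  y + (suc q * x + q * y)              ≡⟨ regroup x y q ⟩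
  suc q * (x + y)                      ≡⟨ cong (suc q *_) (nCk+nC[k+1]≡[n+1]C[k+1] (suc (p + q)) p) ⟩
  suc q * (suc (suc (p + q)) C suc p)  ∎
  where
  open ≡-Reasoning
  x = suc (p + q) C p
  y = suc (p + q) C suc p
  regroup : ∀ x y q → y + (suc q * x + q * y) ≡ suc q * (x + y)
  regroup = solve 3 (λ x y q → y :+ ((con 1 :+ q) :* x :+ q :* y)
                             := (con 1 :+ q) :* (x :+ y)) refl
    where open +-*-Solver

markedShuffle-count : ∀ p q → MarkedShuffle p q ↔ Fin (edgeCount p q)
markedShuffle-count zero    q       = ¬⇒↔Fin0 ¬MarkedShuffle-zeroˡ
markedShuffle-count (suc p) zero    = ¬⇒↔Fin0 ¬MarkedShuffle-zeroʳ
markedShuffle-count (suc p) (suc q) =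
  subst (λ n → MarkedShuffle (suc p) (suc q) ↔ Fin n) (edgeCount-suc p q)
    (↔-trans (MarkedShuffle-suc p q)
      (⊎-↔Fin (shuffle-count p q)
        (⊎-↔Fin (markedShuffle-count p (suc q)) (markedShuffle-count (suc p) q))))

edge-count : ∀ p q → ∣E A p q ∣≡ edgeCount p q
edge-count p q = Composition.inverse
  (Symmetry.inverse (Bijection⇒Inverse markedShuffle⤖edge)) (markedShuffle-count p q)

theorem3p2 : (p q : ℕ) →
    (1 ≤ p → 1 ≤ q → ∣E A p q ∣≡ (q * ((p + q ∸ 1) C (p ∸ 1)))) ×
    (p * q ≡ 0 → ∣E A p q ∣≡ 0)
theorem3p2 zero    q       = (λ ()) , λ _ → edge-count zero q
theorem3p2 (suc p) zero    = (λ _ ()) , λ _ → edge-count (suc p) zero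
-- Here `suc p + suc q ∸ 1` and `suc p ∸ 1` compute to `p + suc q` and `p`, so the formula is
-- `edgeCount` by definition, and the product is a successor.
theorem3p2 (suc p) (suc q) = (λ _ _ → edge-count (suc p) (suc q)) , λ ()
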